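{- For any connected graph $G$ on $n$ vertices, $$ \log_2 n \le \mathrm{pq}(G) \le \mathrm{eq}(G) \le n-1. $$ In fact, there exists a strategy of the algorithm, using edge queries, that in each round (as long as at least two potential targets remain) eliminates at least one vertex from the search space, that is, $|V_t|\le |V_{t-1}|-1$ whenever $|V_{t-1}|\ge 2$, regardless of the replies of the adversary.
   Context: Query game on a simple graph $G=(V,E)$: $d_G(u,v)$ denotes the graph distance. An adversary fixes a target vertex $v^*\in V$ unknown to an adaptive algorithm. In each round the algorithm queries two vertices $u,v$, and the adversary replies with whichever of $u,v$ is closer to $v^*$ (with either one, at the adversary's choice, if $d_G(u,v^*)=d_G(v,v^*)$). Equivalently: put $V_0=V$; in round $t$ the algorithm presents $(u_t,v_t)$ (depending on $G$ and earlier replies) and the adversary chooses either $V_t=\{x\in V_{t-1}: d_G(u_t,x)\le d_G(v_t,x)\}$ (reply $u_t$) or $V_t=\{x\in V_{t-1}: d_G(v_t,x)\le d_G(u_t,x)\}$ (reply $v_t$); $V_t$ is the search space (set of potential targets) after $t$ rounds, and the target is located once $|V_t|=1$. A pair query allows arbitrary $u,v\in V$; an edge query requires $u$ and $v$ to be adjacent. $\mathrm{pq}(G)$ (respectively $\mathrm{eq}(G)$) is the least integer $t$ such that the algorithm can locate the target in at most $t$ pair queries (respectively edge queries), regardless of the strategy of the adversary. -}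

module Defs where

open import Data.Fin.Base using (Fin)
open import Data.Fin.Properties using (_≟_; any?)
open import Data.Fin.Subset using (Subset; ⊤; _∩_; ∣_∣)
open import Data.List.Base using (List; []; _∷_; length)
open import Data.Maybe.Base using (Maybe; just; nothing)
open import Data.Nat.Base using (ℕ; zero; suc; _≤_; z≤n; s≤s)
open import Data.Nat.Properties using (_≤?_)
open import Data.Product.Base using (∃; ∃₂; _×_; _,_; proj₁)
open import Data.Unit.Base using (tt) renaming (⊤ to Unit)
open import Data.Vec.Base using (tabulate)
open import Level using (0ℓ)
open import Relation.Binary.Construct.Always using (Always)
open import Relation.Binary.Core using (Rel)
open import Relation.Binary.Definitions using (Symmetric; Irreflexive)
import Relation.Binary.Definitions as B
open import Relation.Binary.PropositionalEquality using (_≡_; refl)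
open import Relation.Nullary.Decidable using (yes; no; does; map′; _×-dec_)
open import Relation.Nullary.Negation using (contradiction)
open import Relation.Unary using (Pred; Decidable)

IsLeast : Pred ℕ 0ℓ → Pred ℕ 0ℓ
IsLeast P k = P k × (∀ j → P j → k ≤ j)

findLeast : {P : Pred ℕ 0ℓ} → Decidable P → ∀ k → P k → ∃ (IsLeast P)
findLeast P? zero p = zero , p , λ _ _ → z≤n
findLeast P? (suc k) p with P? zero
... | yes p₀ = zero , p₀ , λ _ _ → z≤n
... | no ¬p₀ with findLeast (λ j → P? (suc j)) k p
...   | m , pm , m-least = suc m , pm , λ where
        zero    p₀ → contradiction p₀ ¬p₀
        (suc j) pj → s≤s (m-least j pj)

-- A finite simple graph is given with decidable adjacency, so that distances
-- and search spaces can be computed.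
record SimpleGraph (n : ℕ) : Set₁ where
  field
    Adj     : Rel (Fin n) 0ℓ
    adj?    : B.Decidable Adj
    symm    : Symmetric Adj
    irrefl  : Irreflexive _≡_ Adj

module _ {n : ℕ} (G : SimpleGraph n) where
  open SimpleGraph G

  data Walk (u : Fin n) : Fin n → ℕ → Set where
    []  : Walk u u 0
    _▻_ : ∀ {v w k} → Walk u v k → Adj v w → Walk u w (suc k)

  -- Connectivity and distance use walks: a shortest walk is a path.
  Connected : Set
  Connected = ∀ u v → ∃ (Walk u v)

  walk? : ∀ u v → Decidable (Walk u v)
  walk? u v zero = map′ (λ { refl → [] }) (λ { [] → refl }) (u ≟ v)
  walk? u v (suc k) =
    map′ (λ { (_ , p , a) → p ▻ a }) (λ { (p ▻ a) → _ , p , a })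
         (any? (λ w → walk? u w k ×-dec adj? w v))

data Reply : Set where
  first second : Reply

module _ {n : ℕ} (G : SimpleGraph n) (conn : Connected G) where
  open SimpleGraph G using (Adj)

  dist : Fin n → Fin n → ℕ
  dist u v = let k , p = conn u v in proj₁ (findLeast (walk? G u v) k p)

  -- `Q` is the relation that the two queried vertices must satisfy.
  Query : Rel (Fin n) 0ℓ → Set
  Query Q = ∃₂ λ u v → Q u v

  -- A strategy sees the replies of all earlier rounds, most recent first.
  -- `nothing` is an idle round without a query; without it there would be no
  -- edge strategy on the one-vertex graph.
  Strategy : Rel (Fin n) 0ℓ → Set
  Strategy Q = List Reply → Maybe (Query Q)

  module _ {Q : Rel (Fin n) 0ℓ} where

    -- `Truthful q r x`: the adversary may give reply r to q if the target is x.
    -- The reply to an idle round carries no information.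
    Truthful : Maybe (Query Q) → Reply → Pred (Fin n) 0ℓ
    Truthful nothing            _      x = Unit
    Truthful (just (u , v , _)) first  x = dist u x ≤ dist v x
    Truthful (just (u , v , _)) second x = dist v x ≤ dist u x

    truthful? : ∀ q r → Decidable (Truthful q r)
    truthful? nothing            _      x = yes tt
    truthful? (just (u , v , _)) first  x = dist u x ≤? dist v x
    truthful? (just (u , v , _)) second x = dist v x ≤? dist u x

    -- `searchSpace σ h` is V_t for t = length h.
    searchSpace : Strategy Q → List Reply → Subset n
    searchSpace σ []      = ⊤
    searchSpace σ (r ∷ h) =
      searchSpace σ h ∩ tabulate (λ x → does (truthful? (σ h) r x))

    TruthfulPlay : Strategy Q → Fin n → List Reply → Set
    TruthfulPlay σ x []      = Unit
    TruthfulPlay σ x (r ∷ h) = TruthfulPlay σ x h × Truthful (σ h) r x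

    -- Idle rounds count towards t, hence "at most t queries".
    LocatesWithin : ℕ → Strategy Q → Set
    LocatesWithin t σ =
      ∀ target h → length h ≡ t → TruthfulPlay σ target h → ∣ searchSpace σ h ∣ ≡ 1

  LocatableWithin : Rel (Fin n) 0ℓ → Pred ℕ 0ℓ
  LocatableWithin Q t = ∃ λ (σ : Strategy Q) → LocatesWithin t σ

  IsPq : ℕ → Set
  IsPq = IsLeast (LocatableWithin Always)

  IsEq : ℕ → Set
  IsEq = IsLeast (LocatableWithin Adj)

{-# OPTIONS --safe #-}
-- Let x ≠ y be two remaining targets and v the second vertex of a shortest walk
-- from x to y. On the edge query (x , v), the reply x eliminates y, which is
-- closer to v, and the reply v eliminates x. Conversely the two possible search
-- spaces after a query cover the old one, so t queries locate the target among
-- at most 2 ^ t vertices. For pq and eq to be computable, locatability within t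
-- rounds is restated as the existence of a finite game tree, which is decidable.
module Submission where

open import Data.Fin.Base using (Fin)
open import Data.Fin.Properties using (any?)
open import Data.Fin.Subset
  using (Subset; inside; outside; ⊤; _∩_; _∪_; _-_; _∈_; _∉_; _⊆_; Nonempty; ∣_∣)
open import Data.Fin.Subset.Properties
open import Data.List.Base using (List; []; _∷_; length)
open import Data.Maybe.Base using (Maybe; just; nothing)
open import Data.Nat.Base
  using (ℕ; zero; suc; pred; NonZero; _+_; _≤_; _<_; _∸_; _^_; z≤n; s≤s; s≤s⁻¹)
open import Data.Nat.Logarithm using (⌈log₂_⌉; ⌈log₂⌉-mono-≤; ⌈log₂2^n⌉≡n)
open import Data.Nat.Properties
open import Data.Product.Base using (Σ; ∃; ∃₂; _×_; _,_; proj₁; proj₂)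
open import Data.Sum.Base using (_⊎_; inj₁; inj₂)
open import Data.Unit.Base using (tt)
open import Data.Vec.Base using (tabulate; []; _∷_; there)
open import Data.Vec.Properties using ([]=⇒lookup; lookup⇒[]=; lookup∘tabulate)
open import Function.Base using (_∘_)
open import Level using (0ℓ)
open import Relation.Binary.Construct.Always using (Always)
open import Relation.Binary.Core using (Rel; _⇒_)
import Relation.Binary.Definitions as B
open import Relation.Binary.PropositionalEquality
open import Relation.Nullary.Decidable
  using (Dec; yes; no; does; map′; dec-true; _×-dec_; _⊎-dec_)
open import Relation.Nullary.Negation using (contradiction)
open import Relation.Unary using (Pred; Decidable)
open import Defs

-- Membership and cardinality of subsets of `Fin n`.

module _ {n : ℕ} {P : Pred (Fin n) 0ℓ} (P? : Decidable P) where

  ∈-tabulate⁺ : ∀ {x} → P x → x ∈ tabulate (does ∘ P?)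
  ∈-tabulate⁺ {x} px =
    lookup⇒[]= x _ (trans (lookup∘tabulate (does ∘ P?) x) (dec-true (P? x) px))

  ∈-tabulate⁻ : ∀ {x} → x ∈ tabulate (does ∘ P?) → P x
  ∈-tabulate⁻ {x} x∈ with P? x | trans (sym (lookup∘tabulate (does ∘ P?) x)) ([]=⇒lookup x∈)
  ... | yes px | _  = px
  ... | no  _  | ()

∣p∪q∣≤∣p∣+∣q∣ : ∀ {n} (p q : Subset n) → ∣ p ∪ q ∣ ≤ ∣ p ∣ + ∣ q ∣
∣p∪q∣≤∣p∣+∣q∣ []            []            = z≤n
∣p∪q∣≤∣p∣+∣q∣ (outside ∷ p) (outside ∷ q) = ∣p∪q∣≤∣p∣+∣q∣ p q
∣p∪q∣≤∣p∣+∣q∣ (outside ∷ p) (inside ∷ q)  =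
  ≤-trans (s≤s (∣p∪q∣≤∣p∣+∣q∣ p q)) (≤-reflexive (sym (+-suc ∣ p ∣ ∣ q ∣)))
∣p∪q∣≤∣p∣+∣q∣ (inside ∷ p)  (outside ∷ q) = s≤s (∣p∪q∣≤∣p∣+∣q∣ p q)
∣p∪q∣≤∣p∣+∣q∣ (inside ∷ p)  (inside ∷ q)  =
  s≤s (≤-trans (∣p∪q∣≤∣p∣+∣q∣ p q) (+-monoʳ-≤ ∣ p ∣ (n≤1+n ∣ q ∣)))

x∈p⇒1≤∣p∣ : ∀ {n} {p : Subset n} {x} → x ∈ p → 1 ≤ ∣ p ∣
x∈p⇒1≤∣p∣ x∈p = ≤-trans (s≤s z≤n) (x∈p⇒∣p-x∣<∣p∣ x∈p)

1≤∣p∣⇒Nonempty : ∀ {n} (p : Subset n) → 1 ≤ ∣ p ∣ → Nonempty p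
1≤∣p∣⇒Nonempty {n} p 1≤∣p∣ with nonempty? p
... | yes ne = ne
... | no  e  = contradiction (trans (cong ∣_∣ (Empty-unique e)) (∣⊥∣≡0 n)) (>⇒≢ 1≤∣p∣)

∣p∣≤1+∣p-x∣ : ∀ {n} (p : Subset n) x → ∣ p ∣ ≤ suc ∣ p - x ∣
∣p∣≤1+∣p-x∣ (outside ∷ p) Fin.zero    = ≤-trans (≤-reflexive (cong ∣_∣ (sym (p─⊥≡p p)))) (n≤1+n _)
∣p∣≤1+∣p-x∣ (inside ∷ p)  Fin.zero    = s≤s (≤-reflexive (cong ∣_∣ (sym (p─⊥≡p p))))
∣p∣≤1+∣p-x∣ (outside ∷ p) (Fin.suc x) = ∣p∣≤1+∣p-x∣ p x
∣p∣≤1+∣p-x∣ (inside ∷ p)  (Fin.suc x) = s≤s (∣p∣≤1+∣p-x∣ p x)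

-- Removing a first element costs at most one, so a second one is left in `p - x`.
2≤∣p∣⇒distinct : ∀ {n} (p : Subset n) → 2 ≤ ∣ p ∣ → ∃₂ λ x y → x ∈ p × y ∈ p × x ≢ y
2≤∣p∣⇒distinct p 2≤∣p∣ with 1≤∣p∣⇒Nonempty p (≤-trans (n≤1+n 1) 2≤∣p∣)
... | x , x∈p with 1≤∣p∣⇒Nonempty (p - x) (s≤s⁻¹ (≤-trans 2≤∣p∣ (∣p∣≤1+∣p-x∣ p x)))
...   | y , y∈p-x = x , y , x∈p , p─q⊆p p _ y∈p-x , λ { refl → x∉p-x p y∈p-x }
  where
  x∉p-x : ∀ {n} (p : Subset n) {x} → x ∉ p - x
  x∉p-x (outside ∷ p) {Fin.zero}  ()
  x∉p-x (inside ∷ p)  {Fin.zero}  ()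
  x∉p-x (_ ∷ p)       {Fin.suc x} (there x∈) = x∉p-x p x∈

∣p∩q∣≤∣p∣∸1 : ∀ {n} (p q : Subset n) {x} → x ∈ p → x ∉ q → ∣ p ∩ q ∣ ≤ ∣ p ∣ ∸ 1
∣p∩q∣≤∣p∣∸1 p q x∈p x∉q =
  <⇒≤pred (p⊂q⇒∣p∣<∣q∣ (p∩q⊆p p q , _ , x∈p , x∉q ∘ p∩q⊆q p q))

-- Walks and distances.

module _ {n : ℕ} (G : SimpleGraph n) where
  open SimpleGraph G

  -- Walks are extended at their end, so the first edge is reached by recursion.
  first-step : ∀ {u w k} → Walk G u w (suc k) → ∃ λ v → Adj u v × Walk G v w k
  first-step ([] ▻ a)      = _ , a , []
  first-step ((p ▻ b) ▻ a) with first-step (p ▻ b)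
  ... | v , c , q = v , c , q ▻ a

module _ {n : ℕ} (G : SimpleGraph n) (conn : Connected G) where
  open SimpleGraph G

  private
    d : Fin n → Fin n → ℕ
    d = dist G conn

  dist-isLeast : ∀ u v → IsLeast (Walk G u v) (d u v)
  dist-isLeast u v = let k , p = conn u v in proj₂ (findLeast (walk? G u v) k p)

  dist-least : ∀ {u v k} → Walk G u v k → d u v ≤ k
  dist-least {u} {v} p = proj₂ (dist-isLeast u v) _ p

  Adj⇒dist>0 : ∀ {u v} → Adj u v → 0 < d v u
  Adj⇒dist>0 {u} {v} a with d v u | proj₁ (dist-isLeast v u)
  ... | zero  | []    = contradiction a (irrefl refl)
  ... | suc _ | _ ▻ _ = s≤s z≤n

  -- What remains of a shortest walk after its first edge is a walk from `v` to `y`, shorter by one.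
  closer-neighbour : ∀ {x y} → x ≢ y → ∃ λ v → Adj x v × d v y < d x y
  closer-neighbour {x} {y} x≢y with d x y | proj₁ (dist-isLeast x y)
  ... | zero  | [] = contradiction refl x≢y
  ... | suc _ | p with first-step G p
  ...   | v , a , q = v , a , s≤s (dist-least q)

  -- Search spaces and strategies.

  module _ {Q : Rel (Fin n) 0ℓ} where

    answers : Maybe (Query G conn Q) → Reply → Subset n
    answers q r = tabulate (λ x → does (truthful? G conn {Q} q r x))

    -- The order on distances is total, so every vertex admits at least one reply; ties admit both.
    p⊆answers : ∀ (p : Subset n) q → p ⊆ (p ∩ answers q first) ∪ (p ∩ answers q second)
    p⊆answers p q {x} x∈p with truthful-one q
      where
      truthful-one : ∀ q → Truthful G conn {Q} q first x ⊎ Truthful G conn {Q} q second x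
      truthful-one nothing            = inj₁ tt
      truthful-one (just (u , v , _)) = ≤-total (d u x) (d v x)
    ... | inj₁ t = x∈p∪q⁺ (inj₁ (x∈p∩q⁺ (x∈p , ∈-tabulate⁺ (truthful? G conn {Q} q first) t)))
    ... | inj₂ t = x∈p∪q⁺ (inj₂ (x∈p∩q⁺ (x∈p , ∈-tabulate⁺ (truthful? G conn {Q} q second) t)))

    ∈searchSpace⁺ : ∀ σ {x} h → TruthfulPlay G conn {Q} σ x h → x ∈ searchSpace G conn σ h
    ∈searchSpace⁺ σ []      _       = ∈⊤
    ∈searchSpace⁺ σ (r ∷ h) (p , t) =
      x∈p∩q⁺ (∈searchSpace⁺ σ h p , ∈-tabulate⁺ (truthful? G conn {Q} (σ h) r) t)

    ∈searchSpace⁻ : ∀ σ {x} h → x ∈ searchSpace G conn {Q} σ h → TruthfulPlay G conn σ x h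
    ∈searchSpace⁻ σ []      _  = tt
    ∈searchSpace⁻ σ (r ∷ h) x∈ with x∈p∩q⁻ (searchSpace G conn σ h) _ x∈
    ... | x∈S , x∈A = ∈searchSpace⁻ σ h x∈S , ∈-tabulate⁻ (truthful? G conn {Q} (σ h) r) x∈A

    -- A truthful play keeps the target in the search space, so only the upper bound is at stake.
    LocatesWithin⁺ : ∀ {t σ} → (∀ h → length h ≡ t → ∣ searchSpace G conn {Q} σ h ∣ ≤ 1) →
                     LocatesWithin G conn t σ
    LocatesWithin⁺ small x h len p =
      ≤-antisym (small h len) (x∈p⇒1≤∣p∣ (∈searchSpace⁺ _ h p))

    -- A history that is truthful for no target has an empty search space, so the bound extends to
    -- all histories.
    LocatesWithin⁻ : ∀ {t σ} → LocatesWithin G conn {Q} t σ →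
                     ∀ h → length h ≡ t → ∣ searchSpace G conn σ h ∣ ≤ 1
    LocatesWithin⁻ {σ = σ} loc h len with nonempty? (searchSpace G conn σ h)
    ... | yes (x , x∈) = ≤-reflexive (loc x h len (∈searchSpace⁻ σ h x∈))
    ... | no  e        = subst (_≤ 1) (sym (trans (cong ∣_∣ (Empty-unique e)) (∣⊥∣≡0 n))) z≤n

    -- A strategy sees only the replies; its internal state is recomputed by folding over them.
    module Automaton {A : Set} (start : A) (move : A → Maybe (Query G conn Q))
                     (next : A → Reply → A) where

      run : List Reply → A
      run []      = start
      run (r ∷ h) = next (run h) r

      strategy : Strategy G conn Q
      strategy = move ∘ run

      searchSpace-run : (space : A → Subset n) → space start ≡ ⊤ →
                        (∀ a r → space (next a r) ≡ space a ∩ answers (move a) r) →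
                        ∀ h → searchSpace G conn strategy h ≡ space (run h)
      searchSpace-run space s₀ s₊ []      = sym s₀
      searchSpace-run space s₀ s₊ (r ∷ h) =
        trans (cong (_∩ _) (searchSpace-run space s₀ s₊ h)) (sym (s₊ (run h) r))

  -- Game trees and their equivalence with strategies.

  -- Trees of depth exactly `k`, padded by idle rounds. Leaves may be empty, since a tree also
  -- branches on replies that no target allows.
  data Solvable (Q : Rel (Fin n) 0ℓ) : ℕ → Subset n → Set where
    done : ∀ {p} → ∣ p ∣ ≤ 1 → Solvable Q 0 p
    ask  : ∀ {k p} (q : Maybe (Query G conn Q)) →
           (∀ r → Solvable Q k (p ∩ answers q r)) → Solvable Q (suc k) p

  allReplies? : {P : Pred Reply 0ℓ} → Decidable P → Dec (∀ r → P r)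
  allReplies? P? = map′ (λ { (a , b) first → a ; (a , b) second → b })
                        (λ f → f first , f second) (P? first ×-dec P? second)

  -- The answers to a query do not depend on the proof that it is admissible.
  solvable? : ∀ {Q} → B.Decidable Q → ∀ k → Decidable (Solvable Q k)
  solvable? Q? zero    p = map′ done (λ { (done s) → s }) (∣ p ∣ ≤? 1)
  solvable? {Q} Q? (suc k) p = map′
    (λ { (inj₁ f) → ask nothing f ; (inj₂ (u , v , a , f)) → ask (just (u , v , a)) f })
    (λ { (ask nothing f) → inj₁ f ; (ask (just (u , v , a)) f) → inj₂ (u , v , a , f) })
    (allReplies? (λ r → solvable? Q? k (p ∩ answers {Q} nothing r))
     ⊎-dec any? λ u → any? λ v → solvableBy? u v (Q? u v))
    where
    solvableBy? : ∀ u v → Dec (Q u v) →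
      Dec (Σ (Q u v) λ a → ∀ r → Solvable Q k (p ∩ answers {Q} (just (u , v , a)) r))
    solvableBy? u v (no ¬a) = no (¬a ∘ proj₁)
    solvableBy? u v (yes a) = map′ (a ,_) (λ { (_ , f) first → f first ; (_ , f) second → f second })
      (allReplies? λ r → solvable? Q? k (p ∩ answers {Q} (just (u , v , a)) r))

  -- With `Adj` inside `Always`, this turns edge strategies into pair strategies.
  Solvable-mono : ∀ {Q R} → Q ⇒ R → ∀ {k p} → Solvable Q k p → Solvable R k p
  Solvable-mono Q⇒R (done s)                   = done s
  Solvable-mono Q⇒R (ask nothing f)            = ask nothing (λ r → Solvable-mono Q⇒R (f r))
  Solvable-mono Q⇒R (ask (just (u , v , a)) f) = ask (just (u , v , Q⇒R a))
    -- Once the reply is known, `truthful?` computes and the answer sets for `Q` and `R` coincide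
    -- definitionally.
    λ { first → Solvable-mono Q⇒R (f first) ; second → Solvable-mono Q⇒R (f second) }

  -- Each of the `2 ^ k` leaves holds at most one vertex, and every vertex of `p` survives to some
  -- leaf.
  Solvable⇒∣p∣≤2^k : ∀ {Q k p} → Solvable Q k p → ∣ p ∣ ≤ 2 ^ k
  Solvable⇒∣p∣≤2^k (done s) = s
  Solvable⇒∣p∣≤2^k {k = suc k} {p} (ask q f) = begin
    ∣ p ∣                                               ≤⟨ p⊆q⇒∣p∣≤∣q∣ (p⊆answers p q) ⟩
    ∣ (p ∩ answers q first) ∪ (p ∩ answers q second) ∣  ≤⟨ ∣p∪q∣≤∣p∣+∣q∣ (p ∩ answers q first) _ ⟩
    ∣ p ∩ answers q first ∣ + ∣ p ∩ answers q second ∣  ≤⟨ +-mono-≤ (Solvable⇒∣p∣≤2^k (f first))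
                                                                      (Solvable⇒∣p∣≤2^k (f second)) ⟩
    2 ^ k + 2 ^ k                                       ≡⟨ cong (2 ^ k +_) (+-identityʳ (2 ^ k)) ⟨
    2 ^ suc k                                           ∎
    where open ≤-Reasoning

  -- The strategy is unrolled along all histories; in `go`, `k` counts the rounds still to come.
  LocatableWithin⇒Solvable : ∀ {Q t} → LocatableWithin G conn Q t → Solvable Q t ⊤
  LocatableWithin⇒Solvable {Q} {t} (σ , loc) = go t [] (+-identityʳ t)
    where
    go : ∀ k h → k + length h ≡ t → Solvable Q k (searchSpace G conn σ h)
    go zero    h eq = done (LocatesWithin⁻ loc h eq)
    go (suc k) h eq = ask (σ h) λ r → go k (r ∷ h) (trans (+-suc k (length h)) eq)

  module _ {Q : Rel (Fin n) 0ℓ} where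

    private
      -- The subtree still to be played, with its depth and its search space.
      State : Set
      State = ∃₂ (Solvable Q)

      move : State → Maybe (Query G conn Q)
      move (_ , _ , done _)  = nothing
      move (_ , _ , ask q _) = q

      next : State → Reply → State
      -- Past a leaf the play idles; keeping the intersection unsimplified makes `space-next` hold
      -- by `refl`.
      next (_ , p , done s)  r = _ , p ∩ answers {Q} nothing r , done (≤-trans (∣p∩q∣≤∣p∣ p (answers {Q} nothing r)) s)
      next (_ , _ , ask q f) r = _ , _ , f r

      space : State → Subset n
      space (_ , p , _) = p

      space-next : ∀ s r → space (next s r) ≡ space s ∩ answers (move s) r
      space-next (_ , _ , done _)  r = refl
      space-next (_ , _ , ask _ _) r = refl

      rounds-next : ∀ s r → proj₁ (next s r) ≡ pred (proj₁ s)
      rounds-next (_ , _ , done _)  r = refl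
      rounds-next (_ , _ , ask _ _) r = refl

    -- Every reply descends one level, so after `t` replies the remaining depth is 0 and the state
    -- is a leaf.
    Solvable⇒LocatableWithin : ∀ {t} → Solvable Q t ⊤ → LocatableWithin G conn Q t
    Solvable⇒LocatableWithin {t} w = strategy , LocatesWithin⁺ λ h len →
      subst (λ p → ∣ p ∣ ≤ 1) (sym (searchSpace-run space refl space-next h))
        (finished (run h) (trans (rounds-run h) (trans (cong (t ∸_) len) (n∸n≡0 t))))
      where
      open Automaton (t , ⊤ , w) move next

      rounds-run : ∀ h → proj₁ (run h) ≡ t ∸ length h
      rounds-run []      = refl
      rounds-run (r ∷ h) = trans (rounds-next (run h) r)
        (trans (cong pred (rounds-run h)) (pred[m∸n]≡m∸[1+n] t (length h)))

      finished : ∀ s → proj₁ s ≡ 0 → ∣ space s ∣ ≤ 1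
      finished (_ , _ , done s) _ = s

  locatableWithin? : ∀ {Q} → B.Decidable Q → Decidable (LocatableWithin G conn Q)
  locatableWithin? Q? t =
    map′ Solvable⇒LocatableWithin LocatableWithin⇒Solvable (solvable? Q? t ⊤)

  -- Edge queries that eliminate a vertex.

  -- The query is chosen for every `p`, idle on small ones, so that it defines a total strategy.
  eliminatingQuery : ∀ (p : Subset n) → ∃ λ (q : Maybe (Query G conn Adj)) →
                     2 ≤ ∣ p ∣ → ∀ r → ∣ p ∩ answers q r ∣ ≤ ∣ p ∣ ∸ 1
  eliminatingQuery p with 2 ≤? ∣ p ∣
  ... | no  2≰∣p∣ = nothing , λ 2≤∣p∣ → contradiction 2≤∣p∣ 2≰∣p∣
  ... | yes 2≤∣p∣ with 2≤∣p∣⇒distinct p 2≤∣p∣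
  ...   | x , y , x∈p , y∈p , x≢y with closer-neighbour x≢y
  ...     | v , a , dvy<dxy = just q , λ _ → λ where
              first  → ∣p∩q∣≤∣p∣∸1 p (answers (just q) first) y∈p
                (<⇒≱ dvy<dxy ∘ ∈-tabulate⁻ (truthful? G conn {Adj} (just q) first))
              second → ∣p∩q∣≤∣p∣∸1 p (answers (just q) second) x∈p
                -- The empty walk puts `x` at distance 0 from itself, whereas its neighbour `v` is
                -- at positive distance.
                (<⇒≱ (≤-<-trans (dist-least []) (Adj⇒dist>0 a))
                  ∘ ∈-tabulate⁻ (truthful? G conn {Adj} (just q) second))
    where
    q : Query G conn Adj
    q = x , v , a

  ∣p∣≤1+k⇒Solvable : ∀ k p → ∣ p ∣ ≤ suc k → Solvable Adj k p
  ∣p∣≤1+k⇒Solvable zero    p s = done s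
  ∣p∣≤1+k⇒Solvable (suc k) p s with eliminatingQuery p | 2 ≤? ∣ p ∣
  ... | q , elim | yes 2≤∣p∣ = ask q λ r →
    ∣p∣≤1+k⇒Solvable k _ (≤-trans (elim 2≤∣p∣ r) (pred-mono-≤ s))
  -- At most one vertex is left, but the depth is exact: a round is still spent, and no query
  -- enlarges the space.
  ... | q , _    | no  2≰∣p∣ = ask q λ r →
    ∣p∣≤1+k⇒Solvable k _ (≤-trans (∣p∩q∣≤∣p∣ p (answers q r))
      (≤-trans (s≤s⁻¹ (≰⇒> 2≰∣p∣)) (s≤s z≤n)))

  -- The automaton's state is the current search space, which alone determines the query.
  eliminatingStrategy : ∃ λ (σ : Strategy G conn Adj) →
    ∀ h → 2 ≤ ∣ searchSpace G conn σ h ∣ →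
    ∀ r → ∣ searchSpace G conn σ (r ∷ h) ∣ ≤ ∣ searchSpace G conn σ h ∣ ∸ 1
  eliminatingStrategy = strategy , eliminates
    where
    open Automaton ⊤ (proj₁ ∘ eliminatingQuery)
                     (λ p r → p ∩ answers (proj₁ (eliminatingQuery p)) r)

    eliminates : ∀ h → 2 ≤ ∣ searchSpace G conn strategy h ∣ →
      ∀ r → ∣ searchSpace G conn strategy (r ∷ h) ∣ ≤ ∣ searchSpace G conn strategy h ∣ ∸ 1
    eliminates h rewrite searchSpace-run (λ p → p) refl (λ _ _ → refl) h =
      proj₂ (eliminatingQuery (run h))

mainTheorem8 : ∀ (n : ℕ) .{{_ : NonZero n}} (G : SimpleGraph n) (conn : Connected G) →
    (∃₂ λ pq eq → IsPq G conn pq × IsEq G conn eq ×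
    ⌈log₂ n ⌉ ≤ pq × pq ≤ eq × eq ≤ n ∸ 1)
    ×
    (∃ λ (σ : Strategy G conn (SimpleGraph.Adj G)) →
    ∀ h → 2 ≤ ∣ searchSpace G conn σ h ∣ →
    ∀ r → ∣ searchSpace G conn σ (r ∷ h) ∣ ≤ ∣ searchSpace G conn σ h ∣ ∸ 1)
mainTheorem8 n G conn =
  (pq , eq , isPq , isEq , log≤pq , pq≤eq , proj₂ isEq (n ∸ 1) eqBound) , eliminatingStrategy G conn
  where
  open SimpleGraph G

  eqBound : LocatableWithin G conn Adj (n ∸ 1)
  eqBound = Solvable⇒LocatableWithin G conn (∣p∣≤1+k⇒Solvable G conn (n ∸ 1) ⊤
    (≤-reflexive (trans (∣⊤∣≡n n) (sym (suc-pred n)))))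

  edge⇒pair : ∀ {t} → LocatableWithin G conn Adj t → LocatableWithin G conn Always t
  edge⇒pair = Solvable⇒LocatableWithin G conn ∘ Solvable-mono G conn _
            ∘ LocatableWithin⇒Solvable G conn

  -- Both searches for a least value start from the bound `n ∸ 1`, as an edge strategy is also a
  -- pair strategy.
  leastEq = findLeast (locatableWithin? G conn adj?) (n ∸ 1) eqBound
  leastPq = findLeast (locatableWithin? G conn {Always} (λ _ _ → yes _)) (n ∸ 1) (edge⇒pair eqBound)

  eq pq : ℕ
  eq = proj₁ leastEq
  pq = proj₁ leastPq

  isEq : IsEq G conn eq
  isEq = proj₂ leastEq

  isPq : IsPq G conn pq
  isPq = proj₂ leastPq

  pq≤eq : pq ≤ eq
  pq≤eq = proj₂ isPq eq (edge⇒pair (proj₁ isEq))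

  log≤pq : ⌈log₂ n ⌉ ≤ pq
  log≤pq = begin
    ⌈log₂ n ⌉        ≤⟨ ⌈log₂⌉-mono-≤ n≤2^pq ⟩
    ⌈log₂ 2 ^ pq ⌉   ≡⟨ ⌈log₂2^n⌉≡n pq ⟩
    pq               ∎
    where
    open ≤-Reasoning
    n≤2^pq : n ≤ 2 ^ pq
    n≤2^pq = subst (_≤ 2 ^ pq) (∣⊤∣≡n n)
      (Solvable⇒∣p∣≤2^k G conn (LocatableWithin⇒Solvable G conn (proj₁ isPq)))
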